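{- Let $b,c$ be positive integers with $\gcd(b,c)=1$, $b\ne 1$, $c\ne 1$, and $b+c=2^{2l-1}$ for an integer $l\ge 3$. Then: 1. For all integers $m\ge 1$, $n\ge 8$ with $2m+n=\frac{b+c-2}{3}$ there is a perfect coloring of $D(m,n)$ with quotient matrix $\begin{pmatrix} c-2 & b\\ c & b-2\end{pmatrix}$. 2. For $n=\frac{b+c+1}{3}$ there is a perfect coloring of the Hamming graph $H(n,4)$ with quotient matrix $\begin{pmatrix} c+1 & b\\ c & b+1\end{pmatrix}$.
   Context: The Shrikhande graph is the Cayley graph on $\mathbb{Z}_4^2$ with connection set $\{01,03,10,30,11,33\}$. For nonnegative integers $m,n$, $D(m,n)$ is the Cartesian product of $m$ copies of the Shrikhande graph and $n$ copies of $K_4$ (vertex set $(\mathbb{Z}_4^2)^m\times\mathbb{Z}_4^n$; adjacent iff differing in exactly one coordinate by an adjacency of that factor). $H(n,4)=D(0,n)$ is the Cartesian product of $n$ copies of $K_4$. A $2$-coloring (surjective map onto colors $\{1,2\}$) is perfect with quotient matrix $(s_{ij})$ if every vertex of color $i$ has exactly $s_{ij}$ neighbours of color $j$. -}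

module Defs where

open import Data.Nat using (ℕ; zero; suc; _+_; _∸_; _%_)
open import Data.Bool using (Bool; true; false; _∧_; _∨_; not)
open import Data.Fin using (Fin; toℕ)
open import Data.Fin.Properties using (_≟_)
open import Data.Product using (_×_; _,_; Σ; ∃)
open import Data.List using (List; []; _∷_; length; filterᵇ; concatMap; map; cartesianProduct)
open import Data.List using (allFin)
open import Data.Vec using (Vec; []; _∷_)
open import Relation.Nullary.Decidable using (⌊_⌋)
open import Relation.Binary.PropositionalEquality using (_≡_)

-- A finite simple graph given by an exhaustive duplicate-free list of its
-- vertices and a (symmetric, irreflexive) boolean adjacency relation.
record FinGraph : Set₁ where
  field
    V     : Set
    verts : List V
    adj   : V → V → Bool
open FinGraph public

_==₄_ : Fin 4 → Fin 4 → Bool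
x ==₄ y = ⌊ x ≟ y ⌋

diff₄ : Fin 4 → Fin 4 → ℕ
diff₄ x y = (toℕ y + 4 ∸ toℕ x) % 4

natEq : ℕ → ℕ → Bool
natEq zero zero = true
natEq zero (suc _) = false
natEq (suc _) zero = false
natEq (suc m) (suc n) = natEq m n

-- Shrikhande graph: Cayley graph on Z₄² with connection set {01,03,10,30,11,33}
inConn : ℕ → ℕ → Bool
inConn 0 1 = true
inConn 0 3 = true
inConn 1 0 = true
inConn 3 0 = true
inConn 1 1 = true
inConn 3 3 = true
inConn _ _ = false

S : Set
S = Fin 4 × Fin 4

shrikhandeAdj : S → S → Bool
shrikhandeAdj (a , b) (c , d) = inConn (diff₄ a c) (diff₄ b d)

_==S_ : S → S → Bool
(a , b) ==S (c , d) = (a ==₄ c) ∧ (b ==₄ d)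

k4Adj : Fin 4 → Fin 4 → Bool
k4Adj x y = not (x ==₄ y)

vecEq : ∀ {A : Set} {n} → (A → A → Bool) → Vec A n → Vec A n → Bool
vecEq eq [] [] = true
vecEq eq (x ∷ xs) (y ∷ ys) = eq x y ∧ vecEq eq xs ys

powAdj : ∀ {A : Set} {n} → (A → A → Bool) → (A → A → Bool) → Vec A n → Vec A n → Bool
powAdj eq ad [] [] = false
powAdj eq ad (x ∷ xs) (y ∷ ys) =
  (ad x y ∧ vecEq eq xs ys) ∨ (eq x y ∧ powAdj eq ad xs ys)

allVecs : ∀ {A : Set} (n : ℕ) → List A → List (Vec A n)
allVecs zero xs = [] ∷ []
allVecs (suc n) xs = concatMap (λ x → map (x ∷_) (allVecs n xs)) xs

allS : List S
allS = cartesianProduct (allFin 4) (allFin 4)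

D : ℕ → ℕ → FinGraph
D m n = record
  { V     = Vec S m × Vec (Fin 4) n
  ; verts = cartesianProduct (allVecs m allS) (allVecs n (allFin 4))
  ; adj   = λ { (u₁ , u₂) (v₁ , v₂) →
               (powAdj _==S_ shrikhandeAdj u₁ v₁ ∧ vecEq _==₄_ u₂ v₂)
             ∨ (vecEq _==S_ u₁ v₁ ∧ powAdj _==₄_ k4Adj u₂ v₂) }
  }

H4 : ℕ → FinGraph
H4 n = D 0 n

nbrsOfColour : (G : FinGraph) → (V G → Fin 2) → V G → Fin 2 → ℕ
nbrsOfColour G f v j = length (filterᵇ (λ w → adj G v w ∧ ⌊ f w ≟ j ⌋) (verts G))

mat2 : ℕ → ℕ → ℕ → ℕ → Fin 2 → Fin 2 → ℕ
mat2 a b c d Fin.zero Fin.zero = a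
mat2 a b c d Fin.zero (Fin.suc Fin.zero) = b
mat2 a b c d (Fin.suc Fin.zero) Fin.zero = c
mat2 a b c d (Fin.suc Fin.zero) (Fin.suc Fin.zero) = d

IsPerfect2Colouring : (G : FinGraph) → (V G → Fin 2) → (Fin 2 → Fin 2 → ℕ) → Set
IsPerfect2Colouring G f s =
  (∀ (j : Fin 2) → ∃ λ v → f v ≡ j) ×
  (∀ (v : V G) (j : Fin 2) → nbrsOfColour G f v j ≡ s (f v) j)

HasPerfect2Colouring : FinGraph → (Fin 2 → Fin 2 → ℕ) → Set
HasPerfect2Colouring G s = ∃ λ (f : V G → Fin 2) → IsPerfect2Colouring G f s

{-# OPTIONS --safe #-}
-- Write D(m, n) = F × R with F the Shrikhande graph S (part 1) or K₄³ (part 2).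
-- Both have labellings in Z₄² whose neighbour differences are the connection
-- set of S, respectively its complement in the nonzero elements, so a set that
-- is an eigenset in S for -2 is one for 1 in the other case.  The factor R has
-- degree 8(g - 1), g = 4^(l-2), and a perfect colouring onto the complete
-- multipartite graph with g parts of size 8.  That colouring starts from the
-- partition of Z₂⁵ minus a 3-dimensional subspace into eight lines (this is
-- where n ≥ 8 is needed), and is then multiplied by four repeatedly using
-- colourings of D(0,4) and D(2,0) onto K_{4,4,4,4}; an odd number of factors S
-- in R is reached through one colouring of D(1,3) onto K₁₆.
-- To the eight colours of one part attach eight eigensets of F of density r/8
-- that cover every vertex r times.  For any choice of r ∈ {0, 3, 4, 5, 8} in
-- each part, the union is a perfect colouring, and c is the sum of the r's.
module Submission where

open import Defs
open import Algebra.Definitions using (Associative; Commutative; LeftIdentity)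
open import Data.Bool using (Bool; T; true; false; _∧_; _∨_; _xor_; if_then_else_)
open import Data.Bool.Properties using (xor-assoc; xor-comm; ∧-zeroʳ)
  renaming (_≟_ to _≟ᵇ_)
open import Data.Fin using (Fin; suc; toℕ)
open import Data.Fin.Patterns using (0F; 1F; 2F; 3F)
open import Data.Fin.Properties using (_≟_)
open import Data.List as List
  using (List; []; _∷_; _++_; map; concatMap; length; filterᵇ; cartesianProduct; allFin)
open import Data.List.Properties using (map-∘; map-cong; map-++; ++-assoc; ++-identityʳ)
open import Data.List.Relation.Binary.Permutation.Propositional
  using (_↭_; ↭-refl; ↭-trans; prep; swap)
open import Data.List.Relation.Binary.Permutation.Propositional.Properties using (map⁺)
open import Data.Maybe using (Maybe; just; nothing; zipWith; is-just; to-witness-T)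
  renaming (map to mapᴹ; _>>=_ to _>>=ᴹ_)
open import Data.Nat using (ℕ; zero; suc; _+_; _*_; _∸_; _^_; _≤_; z≤n; s≤s; _≤?_)
open import Data.Nat.Divisibility using (_∣_; divides; ∣m+n∣m⇒∣n; m∣m*n; ∣1⇒≡1)
open import Data.Nat.DivMod using (_mod_)
open import Data.Nat.GCD using (gcd; gcd-greatest; gcd-comm)
open import Data.Nat.ListAction using (sum)
open import Data.Nat.ListAction.Properties using (sum-↭; sum-++)
open import Data.Nat.Properties hiding (_≟_; _≤?_)
open import Algebra.Properties.CommutativeSemigroup +-commutativeSemigroup using (interchange)
open import Data.Nat.Properties using () renaming (_≟_ to _≟ⁿ_)
open import Data.Nat.Tactic.RingSolver using (solve-∀)
open import Data.Product using (_×_; _,_; ∃-syntax; proj₁; proj₂; uncurry)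
open import Data.Product.Properties using (≡-dec)
open import Data.Vec as Vec using (Vec; []; _∷_; take; drop)
open import Function using (_∘_; id)
open import Relation.Binary.Definitions using (DecidableEquality)
open import Relation.Binary.PropositionalEquality
open import Relation.Nullary using (yes; no; contradiction)
open import Relation.Nullary.Decidable using (⌊_⌋; dec⇒maybe)

private variable
  A B : Set
  a b a′ b′ n : ℕ

-- Finite sums

∑ : List A → (A → ℕ) → ℕ
∑ xs h = sum (map h xs)

∑-cong : ∀ (xs : List A) {g h : A → ℕ} → (∀ x → g x ≡ h x) → ∑ xs g ≡ ∑ xs h
∑-cong xs g≗h = cong sum (map-cong g≗h xs)

∑-map : ∀ (f : A → B) xs {h : B → ℕ} → ∑ (map f xs) h ≡ ∑ xs (h ∘ f)
∑-map f xs = cong sum (sym (map-∘ xs))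

∑-++ : ∀ (xs ys : List A) {h : A → ℕ} → ∑ (xs ++ ys) h ≡ ∑ xs h + ∑ ys h
∑-++ xs ys {h} = trans (cong sum (map-++ h xs ys)) (sum-++ (map h xs) (map h ys))

∑-concatMap : ∀ (f : A → List B) xs {h : B → ℕ} →
  ∑ (concatMap f xs) h ≡ ∑ xs (λ x → ∑ (f x) h)
∑-concatMap f [] = refl
∑-concatMap f (x ∷ xs) = trans (∑-++ (f x) _) (cong (_ +_) (∑-concatMap f xs))

∑-zero : ∀ (xs : List A) → ∑ xs (λ _ → 0) ≡ 0
∑-zero [] = refl
∑-zero (_ ∷ xs) = ∑-zero xs

∑-+ : ∀ (xs : List A) {g h : A → ℕ} → ∑ xs (λ x → g x + h x) ≡ ∑ xs g + ∑ xs h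
∑-+ [] = refl
∑-+ (x ∷ xs) {g} {h} = trans (cong (g x + h x +_) (∑-+ xs)) (interchange (g x) (h x) _ _)

∑-comm : ∀ (xs : List A) (ys : List B) {h : A → B → ℕ} →
  ∑ xs (λ x → ∑ ys (h x)) ≡ ∑ ys (λ y → ∑ xs (λ x → h x y))
∑-comm [] ys = sym (∑-zero ys)
∑-comm (x ∷ xs) ys {h} = trans (cong (_ +_) (∑-comm xs ys)) (sym (∑-+ ys))

∑-↭ : ∀ {xs ys : List A} → xs ↭ ys → ∀ h → ∑ xs h ≡ ∑ ys h
∑-↭ p h = sum-↭ (map⁺ h p)

∑-× : ∀ (xs : List A) (ys : List B) {h : A × B → ℕ} →
  ∑ (cartesianProduct xs ys) h ≡ ∑ xs (λ x → ∑ ys (λ y → h (x , y)))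
∑-× [] ys = refl
∑-× (x ∷ xs) ys = trans (∑-++ (map (x ,_) ys) _) (cong₂ _+_ (∑-map (x ,_) ys) (∑-× xs ys))

-- Proofs by evaluation over finite sets

-- The implicit argument is solved exactly when `m` evaluates to a `just`, so the type checker
-- itself carries out the finite verification.
certify : (m : Maybe A) {_ : T (is-just m)} → A
certify m {t} = to-witness-T m t

Exhaust : Set → Set₁
Exhaust A = {P : A → Set} → (∀ x → Maybe (P x)) → Maybe (∀ x → P x)

exhaustᵇ : Exhaust Bool
exhaustᵇ p = zipWith (λ f t → λ { false → f ; true → t }) (p false) (p true)

exhaust₂ : Exhaust (Fin 2)
exhaust₂ p = zipWith (λ q r → λ { 0F → q ; 1F → r }) (p 0F) (p 1F)

exhaust₄ : Exhaust (Fin 4)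
exhaust₄ p = zipWith (λ { (q , r) (s , t) → λ { 0F → q ; 1F → r ; 2F → s ; 3F → t } })
  (zipWith _,_ (p 0F) (p 1F)) (zipWith _,_ (p 2F) (p 3F))

_⊠_ : Exhaust A → Exhaust B → Exhaust (A × B)
(all ⊠ all′) p = mapᴹ uncurry (all (λ x → all′ (λ y → p (x , y))))

remove : DecidableEquality A → (x : A) (ys : List A) → Maybe (∃[ zs ] x ∷ zs ↭ ys)
remove _≟_ x [] = nothing
remove _≟_ x (y ∷ ys) with x ≟ y
... | yes refl = just (ys , ↭-refl)
... | no _ = mapᴹ (λ { (zs , p) → y ∷ zs , ↭-trans (swap x y ↭-refl) (prep y p) }) (remove _≟_ x ys)

-- Greedy matching is complete here, since equal entries are interchangeable.
permutation? : DecidableEquality A → (xs ys : List A) → Maybe (xs ↭ ys)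
permutation? _≟_ [] [] = just ↭-refl
permutation? _≟_ [] (_ ∷ _) = nothing
permutation? _≟_ (x ∷ xs) ys = remove _≟_ x ys >>=ᴹ λ { (zs , p) →
  mapᴹ (λ q → ↭-trans (prep x q) p) (permutation? _≟_ xs zs) }

-- Neighbours as lists

nbrsᴷ : Fin 4 → List (Fin 4)
nbrsᴷ x = filterᵇ (k4Adj x) (allFin 4)

nbrsˢ : S → List S
nbrsˢ z = filterᵇ (shrikhandeAdj z) allS

nbrsᵛ : (A → List A) → Vec A n → List (Vec A n)
nbrsᵛ nb [] = []
nbrsᵛ nb (x ∷ xs) = map (_∷ xs) (nb x) ++ map (x ∷_) (nbrsᵛ nb xs)

nbrsᴰ : V (D a b) → List (V (D a b))
nbrsᴰ (u , v) = map (_, v) (nbrsᵛ nbrsˢ u) ++ map (u ,_) (nbrsᵛ nbrsᴷ v)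

∑ᵛ-∷ : ∀ (nb : A → List A) x (xs : Vec A n) {h} →
  ∑ (nbrsᵛ nb (x ∷ xs)) h ≡ ∑ (nb x) (h ∘ (_∷ xs)) + ∑ (nbrsᵛ nb xs) (h ∘ (x ∷_))
∑ᵛ-∷ nb x xs = trans (∑-++ (map (_∷ xs) (nb x)) _)
  (cong₂ _+_ (∑-map _ (nb x)) (∑-map _ (nbrsᵛ nb xs)))

∑ᴰ : ∀ (u : Vec S a) (v : Vec (Fin 4) b) {h} →
  ∑ (nbrsᴰ (u , v)) h ≡
  ∑ (nbrsᵛ nbrsˢ u) (λ u′ → h (u′ , v)) + ∑ (nbrsᵛ nbrsᴷ v) (λ v′ → h (u , v′))
∑ᴰ u v = trans (∑-++ (map (_, v) (nbrsᵛ nbrsˢ u)) _)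
  (cong₂ _+_ (∑-map _ (nbrsᵛ nbrsˢ u)) (∑-map _ (nbrsᵛ nbrsᴷ v)))

-- A neighbour changes a single coordinate, which lies either among the first `m` or among the
-- remaining ones.
∑ᵛ-split : ∀ (nb : A → List A) m (xs : Vec A (m + n)) (h : Vec A m → Vec A n → ℕ) →
  ∑ (nbrsᵛ nb xs) (λ w → h (take m w) (drop m w)) ≡
  ∑ (nbrsᵛ nb (take m xs)) (λ w → h w (drop m xs)) + ∑ (nbrsᵛ nb (drop m xs)) (h (take m xs))
∑ᵛ-split nb zero xs h = refl
∑ᵛ-split nb (suc m) (x ∷ xs) h = begin
  ∑ (nbrsᵛ nb (x ∷ xs)) (λ w → h (take (suc m) w) (drop (suc m) w))
    ≡⟨ ∑ᵛ-∷ nb x xs ⟩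
  X + ∑ (nbrsᵛ nb xs) (λ w → h (x ∷ take m w) (drop m w))
    ≡⟨ cong (X +_) (∑ᵛ-split nb m xs (h ∘ (x ∷_))) ⟩
  X + (Y + Z)
    ≡⟨ +-assoc X Y Z ⟨
  (X + Y) + Z
    ≡⟨ cong (_+ Z) (∑ᵛ-∷ nb x (take m xs)) ⟨
  ∑ (nbrsᵛ nb (x ∷ take m xs)) (λ w → h w (drop m xs)) + Z ∎
  where
  open ≡-Reasoning
  X = ∑ (nb x) (λ y → h (y ∷ take m xs) (drop m xs))
  Y = ∑ (nbrsᵛ nb (take m xs)) (λ w → h (x ∷ w) (drop m xs))
  Z = ∑ (nbrsᵛ nb (drop m xs)) (h (x ∷ take m xs))

-- Label groups

record Labels : Set₁ where
  infixl 6 _⊕_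
  field
    Carrier   : Set
    _⊕_       : Carrier → Carrier → Carrier
    ε         : Carrier
    ⊕-assoc     : Associative _≡_ _⊕_
    ⊕-comm      : Commutative _≡_ _⊕_
    ⊕-identityˡ : LeftIdentity _≡_ ε _⊕_

open Labels using (Carrier; ε; ⊕-assoc; ⊕-comm; ⊕-identityˡ)

add : (G : Labels) → Carrier G → Carrier G → Carrier G
add = Labels._⊕_

infixl 6 add
syntax add G x y = x ⊕[ G ] y

_⊗_ : Labels → Labels → Labels
G ⊗ H = record
  { Carrier = Carrier G × Carrier H
  ; _⊕_ = λ { (x , y) (x′ , y′) → (x ⊕[ G ] x′) , (y ⊕[ H ] y′) }
  ; ε = ε G , ε H
  ; ⊕-assoc = λ { (x , y) (x′ , y′) (x″ , y″) → cong₂ _,_ (⊕-assoc G x x′ x″) (⊕-assoc H y y′ y″) }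
  ; ⊕-comm = λ { (x , y) (x′ , y′) → cong₂ _,_ (⊕-comm G x x′) (⊕-comm H y y′) }
  ; ⊕-identityˡ = λ { (x , y) → cong₂ _,_ (⊕-identityˡ G x) (⊕-identityˡ H y) }
  }
infixr 5 _⊗_

Z₂ : Labels
Z₂ = record
  { Carrier = Bool ; _⊕_ = _xor_ ; ε = false
  ; ⊕-assoc = xor-assoc ; ⊕-comm = xor-comm ; ⊕-identityˡ = λ _ → refl }

Z₂² Z₂³ : Labels
Z₂² = Z₂ ⊗ Z₂
Z₂³ = Z₂ ⊗ Z₂²

_+₄_ : Fin 4 → Fin 4 → Fin 4
x +₄ y = (toℕ x + toℕ y) mod 4

Z₄ : Labels
Z₄ = record
  { Carrier = Fin 4 ; _⊕_ = _+₄_ ; ε = 0F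
  ; ⊕-assoc = certify (exhaust₄ λ x → exhaust₄ λ y → exhaust₄ λ z → dec⇒maybe ((x +₄ y) +₄ z ≟ x +₄ (y +₄ z)))
  ; ⊕-comm = certify (exhaust₄ λ x → exhaust₄ λ y → dec⇒maybe (x +₄ y ≟ y +₄ x))
  ; ⊕-identityˡ = certify (exhaust₄ λ x → dec⇒maybe (0F +₄ x ≟ x)) }

Z₄² : Labels
Z₄² = Z₄ ⊗ Z₄

⊕-swap : ∀ G x y z → x ⊕[ G ] (y ⊕[ G ] z) ≡ y ⊕[ G ] (x ⊕[ G ] z)
⊕-swap G x y z = begin
  x ⊕[ G ] (y ⊕[ G ] z)  ≡⟨ ⊕-assoc G x y z ⟨
  (x ⊕[ G ] y) ⊕[ G ] z  ≡⟨ cong (λ w → w ⊕[ G ] z) (⊕-comm G x y) ⟩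
  (y ⊕[ G ] x) ⊕[ G ] z  ≡⟨ ⊕-assoc G y x z ⟩
  y ⊕[ G ] (x ⊕[ G ] z)  ∎
  where open ≡-Reasoning

-- The neighbours of v carry the labels t ⊕ label v, t ∈ T: the labelling is a
-- perfect colouring whose quotient is the Cayley multigraph of T.
record Labelling (a b : ℕ) (G : Labels) (T : List (Carrier G)) : Set where
  field
    label     : V (D a b) → Carrier G
    label-nbr : ∀ h v → ∑ (nbrsᴰ v) (h ∘ label) ≡ ∑ T (λ t → h (t ⊕[ G ] label v))
open Labelling

empty : ∀ {G} → Labelling 0 0 G []
empty {G} = record { label = λ _ → ε G ; label-nbr = λ { h ([] , []) → refl } }

infixr 5 _⊎ᴸ_
-- A step in the product moves one factor only, so it adds a member of `T` or of `T′` to the sum of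
-- the two labels; commutativity brings it to the front.
_⊎ᴸ_ : ∀ {G T T′} → Labelling a b G T → Labelling a′ b′ G T′ →
  Labelling (a + a′) (b + b′) G (T ++ T′)
_⊎ᴸ_ {a} {b} {a′} {b′} {G} {T} {T′} F F′ = record { label = f ; label-nbr = nbr }
  where
  open ≡-Reasoning
  f : V (D (a + a′) (b + b′)) → Carrier G
  f (u , v) = label F (take a u , take b v) ⊕[ G ] label F′ (drop a u , drop b v)
  nbr : ∀ h w → ∑ (nbrsᴰ w) (h ∘ f) ≡ ∑ (T ++ T′) (λ t → h (t ⊕[ G ] f w))
  nbr h (u , v) = begin
    ∑ (nbrsᴰ (u , v)) (h ∘ f)
      ≡⟨ ∑ᴰ u v ⟩
    ∑ (nbrsᵛ nbrsˢ u) (λ u′ → h (f (u′ , v))) + ∑ (nbrsᵛ nbrsᴷ v) (λ v′ → h (f (u , v′)))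
      ≡⟨ cong₂ _+_
           (∑ᵛ-split nbrsˢ a u (λ x y → h (label F (x , v₁) ⊕[ G ] label F′ (y , v₂))))
           (∑ᵛ-split nbrsᴷ b v (λ x y → h (label F (u₁ , x) ⊕[ G ] label F′ (u₂ , y)))) ⟩
    (P + Q) + (P′ + Q′)
      ≡⟨ interchange P Q P′ Q′ ⟩
    (P + P′) + (Q + Q′)
      ≡⟨ cong₂ _+_ (∑ᴰ u₁ v₁) (∑ᴰ u₂ v₂) ⟨
    ∑ (nbrsᴰ (u₁ , v₁)) (λ w → h (label F w ⊕[ G ] c₂)) + ∑ (nbrsᴰ (u₂ , v₂)) (λ w → h (c₁ ⊕[ G ] label F′ w))
      ≡⟨ cong₂ _+_ (label-nbr F (λ x → h (x ⊕[ G ] c₂)) _) (label-nbr F′ (λ x → h (c₁ ⊕[ G ] x)) _) ⟩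
    ∑ T (λ t → h ((t ⊕[ G ] c₁) ⊕[ G ] c₂)) + ∑ T′ (λ t → h (c₁ ⊕[ G ] (t ⊕[ G ] c₂)))
      ≡⟨ cong₂ _+_ (∑-cong T (λ t → cong h (⊕-assoc G t c₁ c₂))) (∑-cong T′ (λ t → cong h (⊕-swap G c₁ t c₂))) ⟩
    ∑ T (λ t → h (t ⊕[ G ] (c₁ ⊕[ G ] c₂))) + ∑ T′ (λ t → h (t ⊕[ G ] (c₁ ⊕[ G ] c₂)))
      ≡⟨ ∑-++ T T′ ⟨
    ∑ (T ++ T′) (λ t → h (t ⊕[ G ] (c₁ ⊕[ G ] c₂))) ∎
    where
    u₁ = take a u
    u₂ = drop a u
    v₁ = take b v
    v₂ = drop b v
    c₁ = label F (u₁ , v₁)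
    c₂ = label F′ (u₂ , v₂)
    P = ∑ (nbrsᵛ nbrsˢ u₁) (λ x → h (label F (x , v₁) ⊕[ G ] c₂))
    Q = ∑ (nbrsᵛ nbrsˢ u₂) (λ y → h (c₁ ⊕[ G ] label F′ (y , v₂)))
    P′ = ∑ (nbrsᵛ nbrsᴷ v₁) (λ x → h (label F (u₁ , x) ⊕[ G ] c₂))
    Q′ = ∑ (nbrsᵛ nbrsᴷ v₂) (λ y → h (c₁ ⊕[ G ] label F′ (u₂ , y)))

-- The condition compares multisets of translates only, so it also admits maps such as `digits` that
-- are not homomorphisms.
relabel : ∀ {G H T T′} (g : Carrier G → Carrier H) →
  (∀ h x → ∑ T (λ t → h (g (t ⊕[ G ] x))) ≡ ∑ T′ (λ t → h (t ⊕[ H ] g x))) →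
  Labelling a b G T → Labelling a b H T′
relabel g cover F = record
  { label = g ∘ label F
  ; label-nbr = λ h v → trans (label-nbr F (h ∘ g) v) (cover h (label F v)) }

reorder : ∀ {G T T′} → (∀ h → ∑ T h ≡ ∑ T′ h) → Labelling a b G T → Labelling a b G T′
reorder T≈T′ = relabel id (λ h x → T≈T′ _)

permute : ∀ {G T T′} → T ↭ T′ → Labelling a b G T → Labelling a b G T′
permute p = reorder (∑-↭ p)

hom : ∀ {G H T} (g : Carrier G → Carrier H) →
  (∀ x y → g (x ⊕[ G ] y) ≡ g x ⊕[ H ] g y) →
  Labelling a b G T → Labelling a b H (map g T)
hom {T = T} g g-⊕ = relabel g λ h x →
  trans (∑-cong T (λ t → cong h (g-⊕ t x))) (sym (∑-map g T))

atomᴷ : ∀ {G T} (f : Fin 4 → Carrier G) →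
  (∀ x → map f (nbrsᴷ x) ↭ map (λ t → t ⊕[ G ] f x) T) → Labelling 0 1 G T
atomᴷ {T = T} f p = record
  { label = λ { ([] , x ∷ []) → f x }
  ; label-nbr = λ { h ([] , x ∷ []) → begin
      ∑ (nbrsᴰ ([] , x ∷ [])) _    ≡⟨ ∑ᴰ [] (x ∷ []) ⟩
      ∑ (nbrsᵛ nbrsᴷ (x ∷ [])) _   ≡⟨ ∑ᵛ-∷ nbrsᴷ x [] ⟩
      ∑ (nbrsᴷ x) (h ∘ f) + 0      ≡⟨ +-identityʳ _ ⟩
      ∑ (nbrsᴷ x) (h ∘ f)          ≡⟨ ∑-map f (nbrsᴷ x) ⟨
      ∑ (map f (nbrsᴷ x)) h        ≡⟨ ∑-↭ (p x) h ⟩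
      ∑ (map _ T) h                ≡⟨ ∑-map _ T ⟩
      ∑ T _                        ∎ } }
  where open ≡-Reasoning

atomˢ : ∀ {G T} (f : S → Carrier G) →
  (∀ x → map f (nbrsˢ x) ↭ map (λ t → t ⊕[ G ] f x) T) → Labelling 1 0 G T
atomˢ {T = T} f p = record
  { label = λ { (x ∷ [] , []) → f x }
  ; label-nbr = λ { h (x ∷ [] , []) → begin
      ∑ (nbrsᴰ (x ∷ [] , [])) _       ≡⟨ ∑ᴰ (x ∷ []) [] ⟩
      ∑ (nbrsᵛ nbrsˢ (x ∷ [])) _ + 0  ≡⟨ +-identityʳ _ ⟩
      ∑ (nbrsᵛ nbrsˢ (x ∷ [])) _      ≡⟨ ∑ᵛ-∷ nbrsˢ x [] ⟩
      ∑ (nbrsˢ x) (h ∘ f) + 0         ≡⟨ +-identityʳ _ ⟩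
      ∑ (nbrsˢ x) (h ∘ f)             ≡⟨ ∑-map f (nbrsˢ x) ⟨
      ∑ (map f (nbrsˢ x)) h           ≡⟨ ∑-↭ (p x) h ⟩
      ∑ (map _ T) h                   ≡⟨ ∑-map _ T ⟩
      ∑ T _                           ∎ } }
  where open ≡-Reasoning

-- Labellings of K₄, S and small products of them

X : Set
X = Carrier Z₂²

_≟ˣ_ : DecidableEquality X
_≟ˣ_ = ≡-dec _≟ᵇ_ _≟ᵇ_

_≟²_ : DecidableEquality (X × X)
_≟²_ = ≡-dec _≟ˣ_ _≟ˣ_

_≟ˢ_ : DecidableEquality S
_≟ˢ_ = ≡-dec _≟_ _≟_

exhaustˣ : Exhaust X
exhaustˣ = exhaustᵇ ⊠ exhaustᵇ

exhaustˢ : Exhaust S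
exhaustˢ = exhaust₄ ⊠ exhaust₄

bits : Fin 4 → X
bits 0F = false , false
bits 1F = false , true
bits 2F = true , false
bits 3F = true , true

nonzero : List X
nonzero = bits 1F ∷ bits 2F ∷ bits 3F ∷ []

elemsˣ : List X
elemsˣ = bits 0F ∷ nonzero

K₄-Z₂² : Labelling 0 1 Z₂² nonzero
K₄-Z₂² = atomᴷ bits (certify (exhaust₄ λ x → permutation? _≟ˣ_ _ _))

K₄-Z₄ : Labelling 0 1 Z₄ (1F ∷ 2F ∷ 3F ∷ [])
K₄-Z₄ = atomᴷ id (certify (exhaust₄ λ x → permutation? _≟_ _ _))

connˢ : List S
connˢ = (0F , 1F) ∷ (0F , 3F) ∷ (1F , 0F) ∷ (3F , 0F) ∷ (1F , 1F) ∷ (3F , 3F) ∷ []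

S-Z₄² : Labelling 1 0 Z₄² connˢ
S-Z₄² = atomˢ id (certify (exhaustˢ λ x → permutation? _≟ˢ_ _ _))

-- The subgroups of Z₄² generated by 12, 21 and 13 partition the nonzero
-- elements outside the connection set of the Shrikhande graph.
twelve twentyOne thirteen : Fin 4 → S
twelve x = x , x +₄ x
twentyOne x = x +₄ x , x
thirteen x = x , x +₄ (x +₄ x)

coconnˢ : List S
coconnˢ = map twelve (1F ∷ 2F ∷ 3F ∷ []) ++ map twentyOne (1F ∷ 2F ∷ 3F ∷ []) ++ map thirteen (1F ∷ 2F ∷ 3F ∷ []) ++ []

K₄³-Z₄² : Labelling 0 3 Z₄² coconnˢ
K₄³-Z₄² =
  hom twelve (certify (exhaust₄ λ x → exhaust₄ λ y → dec⇒maybe (_ ≟ˢ _))) K₄-Z₄ ⊎ᴸ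
  hom twentyOne (certify (exhaust₄ λ x → exhaust₄ λ y → dec⇒maybe (_ ≟ˢ _))) K₄-Z₄ ⊎ᴸ
  hom thirteen (certify (exhaust₄ λ x → exhaust₄ λ y → dec⇒maybe (_ ≟ˢ _))) K₄-Z₄ ⊎ᴸ
  empty

-- Their Cayley graphs on X × X are K_{4,4,4,4} and K₁₆.
T₄₄ T₁₆ : List (X × X)
T₄₄ = cartesianProduct nonzero elemsˣ
T₁₆ = T₄₄ ++ map (bits 0F ,_) nonzero

-- Not a homomorphism; only the first component (reduction modulo 2) is one.
digits : S → X × X
digits (x , y) = (lo x , lo y) , (hi x , hi y)
  where
  lo hi : Fin 4 → Bool
  lo 0F = false
  lo 1F = true
  lo 2F = false
  lo 3F = true
  hi 0F = false
  hi 1F = false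
  hi 2F = true
  hi 3F = true

relabel-digits : ∀ {T T′} →
  (∀ x → map (λ t → digits (t ⊕[ Z₄² ] x)) T ↭ map (λ t → t ⊕[ Z₂² ⊗ Z₂² ] digits x) T′) →
  Labelling a b Z₄² T → Labelling a b (Z₂² ⊗ Z₂²) T′
relabel-digits {T = T} {T′} p = relabel digits λ h x →
  trans (sym (∑-map _ T)) (trans (∑-↭ (p x) h) (∑-map _ T′))

-- β = 1 + 2ω with ω of order 3 modulo 2, so ±d and ±βd are the four lifts of d mod 2.
β : S → S
β (x , y) = x +₄ (y +₄ y) , (x +₄ x) +₄ (y +₄ (y +₄ y))

-- The twelve differences `connˢ` and their images under `β` are the elements of Z₄² that are
-- nonzero modulo 2. Hence each label with a different first component is reached once.
unit₂₀ : Labelling 2 0 (Z₂² ⊗ Z₂²) T₄₄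
unit₂₀ = relabel-digits (certify (exhaustˢ λ x → permutation? _≟²_ _ _))
  (S-Z₄² ⊎ᴸ hom β (certify (exhaustˢ λ x → exhaustˢ λ y → dec⇒maybe (_ ≟ˢ _))) S-Z₄²)

-- `connˢ` and `coconnˢ` together exhaust the nonzero elements of Z₄², so every other label is
-- reached once.
unit₁₃ : Labelling 1 3 (Z₂² ⊗ Z₂²) T₁₆
unit₁₃ = relabel-digits (certify (exhaustˢ λ x → permutation? _≟²_ _ _))
  (S-Z₄² ⊎ᴸ K₄³-Z₄²)

-- Multiplication in GF(4) = Z₂[ω], with x₀ + x₁ω written as (x₀ , x₁).
_·_ : X → X → X
(a₀ , a₁) · (x₀ , x₁) = (a₀ ∧ x₀) xor (a₁ ∧ x₁) , (a₀ ∧ x₁) xor ((a₁ ∧ x₀) xor (a₁ ∧ x₁))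

·-distrib : ∀ a x y → a · (x ⊕[ Z₂² ] y) ≡ (a · x) ⊕[ Z₂² ] (a · y)
·-distrib = certify (exhaustˣ λ a → exhaustˣ λ x → exhaustˣ λ y → dec⇒maybe (_ ≟ˣ _))

-- The four lines of finite slope through the origin of GF(4)² partition the pairs with nonzero
-- first coordinate.
unit₀₄ : Labelling 0 4 (Z₂² ⊗ Z₂²) T₄₄
unit₀₄ = permute (certify (permutation? _≟²_ _ _))
  (slope 0F ⊎ᴸ slope 1F ⊎ᴸ slope 2F ⊎ᴸ slope 3F)
  where
  slope : ∀ i → Labelling 0 1 (Z₂² ⊗ Z₂²) (map (λ d → d , bits i · d) nonzero)
  slope i = hom (λ d → d , bits i · d) (λ x y → cong (_ ,_) (·-distrib (bits i) x y)) K₄-Z₂²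

-- The groups `C k` and a partition of the complement of L

C : ℕ → Labels
C zero = Z₂³
C (suc k) = Z₂² ⊗ C k

elems : ∀ k → List (Carrier (C k))
elems zero = cartesianProduct (false ∷ true ∷ []) elemsˣ
elems (suc k) = cartesianProduct elemsˣ (elems k)

-- Multiplication by x₀ + x₁θ in GF(8) = Z₂[θ], θ³ = θ + 1, on k = 0 and in
-- GF(4) on the other coordinates: for x ≠ 0 the map j ↦ α k j x is bijective.
α : ∀ k → Carrier (C k) → X → Carrier (C k)
α zero (j₀ , j₁ , j₂) (x₀ , x₁) =
  (j₀ ∧ x₀) xor (j₂ ∧ x₁) , (j₁ ∧ x₀) xor ((j₀ xor j₂) ∧ x₁) , (j₂ ∧ x₀) xor (j₁ ∧ x₁)
α (suc k) (a , j) x = a · x , α k j x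

decᶜ : ∀ k → DecidableEquality (Carrier (C k))
decᶜ zero = ≡-dec _≟ᵇ_ _≟ˣ_
decᶜ (suc k) = ≡-dec _≟ˣ_ (decᶜ k)

exhaust₈ : Exhaust (Carrier Z₂³)
exhaust₈ = exhaustᵇ ⊠ exhaustˣ

α-⊕ : ∀ k j x y → α k j (x ⊕[ Z₂² ] y) ≡ α k j x ⊕[ C k ] α k j y
α-⊕ zero = certify (exhaust₈ λ j → exhaustˣ λ x → exhaustˣ λ y → dec⇒maybe (decᶜ 0 _ _))
α-⊕ (suc k) (a , j) x y = cong₂ _,_ (·-distrib a x y) (α-⊕ k j x y)

Permutes : ∀ {A} → List A → (A → A) → Set
Permutes xs f = ∀ h → ∑ xs (h ∘ f) ≡ ∑ xs h

permutes-↭ : ∀ (xs : List A) f → map f xs ↭ xs → Permutes xs f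
permutes-↭ xs f p h = trans (sym (∑-map f xs)) (∑-↭ p h)

permutes-× : ∀ (xs : List A) (ys : List B) f g → Permutes xs f → Permutes ys g →
  Permutes (cartesianProduct xs ys) (λ { (x , y) → f x , g y })
permutes-× xs ys f g p q h = begin
  ∑ (cartesianProduct xs ys) _               ≡⟨ ∑-× xs ys ⟩
  ∑ xs (λ x → ∑ ys (λ y → h (f x , g y)))    ≡⟨ ∑-cong xs (λ x → q (λ y → h (f x , y))) ⟩
  ∑ xs (λ x → ∑ ys (λ y → h (f x , y)))      ≡⟨ p (λ x → ∑ ys (λ y → h (x , y))) ⟩
  ∑ xs (λ x → ∑ ys (λ y → h (x , y)))        ≡⟨ ∑-× xs ys ⟨
  ∑ (cartesianProduct xs ys) h               ∎
  where open ≡-Reasoning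

-- Replaces `∑-cong` where `α` is used, because j ↦ `α k j x` is bijective at nonzero x only.
∑-nonzero-cong : ∀ (g h : X → ℕ) → (∀ x → g (bits (suc x)) ≡ h (bits (suc x))) → ∑ nonzero g ≡ ∑ nonzero h
∑-nonzero-cong g h g≗h = cong₂ _+_ (g≗h 0F) (cong₂ _+_ (g≗h 1F) (cong (_+ 0) (g≗h 2F)))

exhaust₃ : Exhaust (Fin 3)
exhaust₃ p = zipWith (λ { q (r , s) → λ { 0F → q ; 1F → r ; 2F → s } }) (p 0F) (zipWith _,_ (p 1F) (p 2F))

·-permutes : ∀ x → map (_· bits (suc x)) elemsˣ ↭ elemsˣ
·-permutes = certify (exhaust₃ λ x → permutation? _≟ˣ_ _ _)

α₀-permutes : ∀ x → map (λ j → α 0 j (bits (suc x))) (elems 0) ↭ elems 0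
α₀-permutes = certify (exhaust₃ λ x → permutation? (decᶜ 0) _ _)

⊕ˣ-permutes : ∀ x → map (λ j → j ⊕[ Z₂² ] x) elemsˣ ↭ elemsˣ
⊕ˣ-permutes = certify (exhaustˣ λ x → permutation? _≟ˣ_ _ _)

⊕₀-permutes : ∀ x → map (λ j → j ⊕[ C 0 ] x) (elems 0) ↭ elems 0
⊕₀-permutes = certify (exhaust₈ λ x → permutation? (decᶜ 0) _ _)

α-permutes : ∀ k x → Permutes (elems k) (λ j → α k j (bits (suc x)))
α-permutes zero x = permutes-↭ (elems 0) (λ j → α 0 j (bits (suc x))) (α₀-permutes x)
α-permutes (suc k) x = permutes-× elemsˣ (elems k) (_· bits (suc x)) (λ j → α k j (bits (suc x)))
  (permutes-↭ elemsˣ (_· bits (suc x)) (·-permutes x)) (α-permutes k x)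

⊕-permutes : ∀ k c → Permutes (elems k) (λ j → j ⊕[ C k ] c)
⊕-permutes zero c = permutes-↭ (elems 0) (λ j → j ⊕[ C 0 ] c) (⊕₀-permutes c)
⊕-permutes (suc k) (x , c) = permutes-× elemsˣ (elems k) (λ j → j ⊕[ Z₂² ] x) (λ j → j ⊕[ C k ] c)
  (permutes-↭ elemsˣ (λ j → j ⊕[ Z₂² ] x) (⊕ˣ-permutes x)) (⊕-permutes k c)

-- The subgroup L = 0 × Z₂³, whose cosets are the parts of the multipartite graph.
inL : ∀ k → Carrier Z₂³ → Carrier (C k)
inL zero e = e
inL (suc k) e = bits 0F , inL k e

lift₀ : ∀ k → Carrier (C k) → Carrier (C (suc k))
lift₀ k c = bits 0F , c

-- The graph of the linear map `α 0 j`, a two-dimensional subspace meeting L only in zero.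
line : Carrier (C 0) → X → Carrier (C 1)
line j d = d , α 0 j d

plane : ∀ k → Carrier (C k) → X × X → Carrier (C (2 + k))
plane k j (d , q) = d , q , α k j d

lines : List (Carrier (C 0)) → List (Carrier (C 1))
lines = concatMap (λ j → map (line j) nonzero)

planes : ∀ k → List (Carrier (C k)) → List (Carrier (C (2 + k)))
planes k = concatMap (λ j → map (plane k j) T₄₄)

-- An enumeration of C (1 + k) ∖ L.
outside : ∀ k → List (Carrier (C (suc k)))
outside zero = lines (elems 0)
outside (suc k) = map (lift₀ (suc k)) (outside k) ++ planes k (elems k)

-- After exchanging the sums, each nonzero d is fixed while j varies, and `α k j d` then takes every
-- value once.
∑-nonzero-α : ∀ k (h : X → Carrier (C k) → ℕ) →
  ∑ (elems k) (λ j → ∑ nonzero (λ d → h d (α k j d))) ≡ ∑ nonzero (λ d → ∑ (elems k) (h d))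
∑-nonzero-α k h = trans (∑-comm (elems k) nonzero {λ j d → h d (α k j d)})
  (∑-nonzero-cong (λ d → ∑ (elems k) (λ j → h d (α k j d))) (λ d → ∑ (elems k) (h d)) (λ x → α-permutes k x (h (bits (suc x)))))

-- For each nonzero d, the lines or planes meet every element with first coordinate d exactly once.
-- First coordinate zero leaves L itself when k is zero, and the previous group otherwise.
outside-complement : ∀ k h →
  ∑ (outside k) h + ∑ (elems 0) (h ∘ inL (suc k)) ≡ ∑ (elems (suc k)) h
outside-complement zero h = begin
  ∑ (lines (elems 0)) h + ∑ (elems 0) (λ e → h (bits 0F , e))
    ≡⟨ cong (_+ Z) (∑-concatMap (λ j → map (line j) nonzero) (elems 0) {h}) ⟩
  ∑ (elems 0) (λ j → ∑ (map (line j) nonzero) h) + Z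
    ≡⟨ cong (_+ Z) (∑-cong (elems 0) (λ j → ∑-map (line j) nonzero {h})) ⟩
  ∑ (elems 0) (λ j → ∑ nonzero (λ d → h (d , α 0 j d))) + Z
    ≡⟨ cong (_+ Z) (∑-nonzero-α 0 (λ d c → h (d , c))) ⟩
  ∑ nonzero (λ d → ∑ (elems 0) (λ c → h (d , c))) + Z
    ≡⟨ +-comm _ Z ⟩
  ∑ elemsˣ (λ d → ∑ (elems 0) (λ c → h (d , c)))
    ≡⟨ ∑-× elemsˣ (elems 0) {h} ⟨
  ∑ (elems 1) h ∎
  where
  open ≡-Reasoning
  Z = ∑ (elems 0) (λ e → h (bits 0F , e))
outside-complement (suc k) h = begin
  ∑ (outside (suc k)) h + L
    ≡⟨ cong (_+ L) (∑-++ (map (lift₀ (suc k)) (outside k)) (planes k (elems k))) ⟩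
  ∑ (map (lift₀ (suc k)) (outside k)) h + ∑ (planes k (elems k)) h + L
    ≡⟨ cong₂ (λ x y → x + y + L) (∑-map (lift₀ (suc k)) (outside k)) planes-sum ⟩
  O + N + L
    ≡⟨ trans (+-assoc O N L) (trans (cong (O +_) (+-comm N L)) (sym (+-assoc O L N))) ⟩
  O + L + N
    ≡⟨ cong (_+ N) (outside-complement k (h ∘ lift₀ (suc k))) ⟩
  ∑ elemsˣ (λ d → ∑ (elems (suc k)) (λ c → h (d , c)))
    ≡⟨ ∑-× elemsˣ (elems (suc k)) {h} ⟨
  ∑ (elems (2 + k)) h ∎
  where
  open ≡-Reasoning
  O = ∑ (outside k) (h ∘ lift₀ (suc k))
  L = ∑ (elems 0) (h ∘ inL (2 + k))
  N = ∑ nonzero (λ d → ∑ (elems (suc k)) (λ c → h (d , c)))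
  planes-sum : ∑ (planes k (elems k)) h ≡ N
  planes-sum = begin
    ∑ (planes k (elems k)) h
      ≡⟨ ∑-concatMap (λ j → map (plane k j) T₄₄) (elems k) {h} ⟩
    ∑ (elems k) (λ j → ∑ (map (plane k j) T₄₄) h)
      ≡⟨ ∑-cong (elems k) (λ j → trans (∑-map (plane k j) T₄₄ {h}) (∑-× nonzero elemsˣ {h ∘ plane k j})) ⟩
    ∑ (elems k) (λ j → ∑ nonzero (λ d → ∑ elemsˣ (λ q → h (d , q , α k j d))))
      ≡⟨ ∑-nonzero-α k (λ d c → ∑ elemsˣ (λ q → h (d , q , c))) ⟩
    ∑ nonzero (λ d → ∑ (elems k) (λ c → ∑ elemsˣ (λ q → h (d , q , c))))
      ≡⟨ ∑-cong nonzero (λ d → trans (∑-comm (elems k) elemsˣ {λ c q → h (d , q , c)}) (sym (∑-× elemsˣ (elems k) {λ c → h (d , c)}))) ⟩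
    N ∎

-- Differences outside L reach all other parts and those in L reach the own part. Together they
-- reach the whole group once, so the base point c disappears.
outside-⊕ : ∀ k h c →
  ∑ (outside k) (λ t → h (t ⊕[ C (suc k) ] c)) + ∑ (elems 0) (λ e → h (inL (suc k) e ⊕[ C (suc k) ] c))
    ≡ ∑ (elems (suc k)) h
outside-⊕ k h c = trans (outside-complement k (λ t → h (t ⊕[ C (suc k) ] c))) (⊕-permutes (suc k) c h)

-- Labellings of D(a, b) by C (1 + k) ∖ L

lines-labelling : ∀ js → Labelling 0 (length js) (C 1) (lines js)
lines-labelling [] = empty
lines-labelling (j ∷ js) =
  hom (line j) (λ x y → cong (_ ,_) (α-⊕ 0 j x y)) K₄-Z₂² ⊎ᴸ lines-labelling js

plane-labelling : ∀ k j → Labelling a b (Z₂² ⊗ Z₂²) T₄₄ → Labelling a b (C (2 + k)) (map (plane k j) T₄₄)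
plane-labelling k j = hom (plane k j) (λ { (d , q) (d′ , q′) → cong (λ c → _ , _ , c) (α-⊕ k j d d′) })

lift₀-labelling : ∀ k {T} → Labelling a b (C k) T → Labelling a b (C (suc k)) (map (lift₀ k) T)
lift₀-labelling k = hom (lift₀ k) (λ _ _ → refl)

-- S has degree 6 and K₄ degree 3, so N is a third of the degree of D(a, b): one list of differences
-- is to serve all these products.
Labels-all : ℕ → (k : ℕ) → List (Carrier (C k)) → Set
Labels-all N k T = ∀ a b → 2 * a + b ≡ N → 8 ≤ b → Labelling a b (C k) T

cast : ∀ {G T} → a ≡ a′ → b ≡ b′ → Labelling a b G T → Labelling a′ b′ G T
cast refl refl F = F

lines-all : Labels-all 8 1 (outside 0)
lines-all zero b refl _ = lines-labelling (elems 0)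
-- The eight factors K₄ use up the whole degree and leave no room for a factor S.
lines-all (suc a) b eq 8≤b = contradiction 8≤b (<⇒≱ (begin-strict
  b                          <⟨ n<1+n b ⟩
  suc b                      ≤⟨ s≤s (m≤n+m b (a + suc (a + 0))) ⟩
  suc (a + suc (a + 0) + b)  ≡⟨ eq ⟩
  8                          ∎))
  where open ≤-Reasoning

-- The new plane is realised on four factors K₄ if there is no S, and on two factors S if there are
-- at least two. A single S permits neither reduction to N with few enough K₄ in general, so that
-- labelling is supplied as an argument.
add-plane : ∀ {N} k {T} j → 8 ≤ N → Labels-all N (2 + k) T →
  Labelling 1 (2 + N) (C (2 + k)) (T ++ map (plane k j) T₄₄) →
  Labels-all (4 + N) (2 + k) (T ++ map (plane k j) T₄₄)
add-plane {N} k j 8≤N F F₁ zero b refl _ =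
  cast refl (+-comm N 4) (F 0 N refl 8≤N ⊎ᴸ plane-labelling k j unit₀₄)
add-plane {N} k j 8≤N F F₁ (suc zero) b eq _ = cast refl (sym (+-cancelˡ-≡ 2 _ _ eq)) F₁
add-plane {N} k j 8≤N F F₁ (suc (suc a)) b eq 8≤b =
  cast (+-comm a 2) (+-identityʳ b)
    (F a b (+-cancelˡ-≡ 4 _ _ (trans (cong (_+ b) (sym (*-distribˡ-+ 2 2 a))) eq)) 8≤b
      ⊎ᴸ plane-labelling k j unit₂₀)

-- From N = 10 on, one S leaves at least eight factors K₄ in the old labelling, so the case of a
-- single S also follows by adding four K₄.
add-planes : ∀ {N} k {T} js → 10 ≤ N → Labels-all N (2 + k) T →
  Labels-all (4 * length js + N) (2 + k) (T ++ planes k js)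
add-planes {N} k {T} [] _ F = subst (Labels-all N (2 + k)) (sym (++-identityʳ T)) F
add-planes {suc (suc N)} k {T} (j ∷ js) 10≤N@(s≤s (s≤s 8≤N)) F =
  subst₂ (λ M → Labels-all M (2 + k)) (count (length js)) (++-assoc T _ _)
    (add-planes k js (m≤n⇒m≤o+n 4 10≤N)
      (add-plane k j (m≤n⇒m≤o+n 2 8≤N) F
        (cast refl (+-comm N 4) (F 1 N refl 8≤N ⊎ᴸ plane-labelling k j unit₀₄))))
  where
  count : ∀ m → 4 * m + (4 + (2 + N)) ≡ 4 * suc m + (2 + N)
  count m = trans (sym (+-assoc (4 * m) 4 (2 + N)))
    (cong (_+ (2 + N)) (trans (+-comm (4 * m) 4) (sym (*-suc 4 m))))

-- With a single factor S, one plane is completed to a copy of Z₂² × Z₂² by the line 0 × Z₂² × 0.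
odd-plane : Labelling 1 10 (C 2) (map (lift₀ 1) (outside 0) ++ map (plane 0 (ε (C 0))) T₄₄)
odd-plane = permute (certify (permutation? (decᶜ 2) _ _))
  (hom {H = C 2} (λ { (p , q) → p , q , ε (C 0) }) (λ _ _ → refl) unit₁₃
    ⊎ᴸ lift₀-labelling 1 (lines-labelling (List.drop 1 (elems 0))))

-- A third of the degree of R: the eight lines have three differences each, every plane has twelve.
weight : ℕ → ℕ
weight zero = 8
weight (suc k) = 4 * length (elems k) + weight k

outside-all : ∀ k → Labels-all (weight k) (suc k) (outside k)
outside-all zero = lines-all
-- `weight 0` is 8, too small for `add-planes`. The first plane is added with `odd-plane` for the
-- case of one S; the other seven start from 12.
outside-all (suc zero) = subst (Labels-all 40 2)
  (++-assoc (map (lift₀ 1) (outside 0)) (map (plane 0 (ε (C 0))) T₄₄) (planes 0 (List.drop 1 (elems 0))))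
  (add-planes 0 (List.drop 1 (elems 0)) (m≤m+n 10 2)
    (add-plane 0 (ε (C 0)) ≤-refl (λ a b eq 8≤b → lift₀-labelling 1 (lines-all a b eq 8≤b)) odd-plane))
outside-all (suc (suc k)) = add-planes (suc k) (elems (suc k)) (10≤weight k)
  (λ a b eq 8≤b → lift₀-labelling (2 + k) (outside-all (suc k) a b eq 8≤b))
  where
  10≤weight : ∀ k → 10 ≤ weight (suc k)
  10≤weight zero = m≤m+n 10 30
  10≤weight (suc k) = m≤n⇒m≤o+n (4 * length (elems (suc k))) (10≤weight k)

-- The degree of R in terms of the order of the label group

length-∑ : ∀ (xs : List A) → length xs ≡ ∑ xs (λ _ → 1)
length-∑ [] = refl
length-∑ (x ∷ xs) = cong suc (length-∑ xs)

length-elems : ∀ k → length (elems k) ≡ 8 * 4 ^ k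
length-elems zero = refl
length-elems (suc k) = begin
  length (elems (suc k))       ≡⟨ length-∑ (elems (suc k)) ⟩
  ∑ (elems (suc k)) (λ _ → 1)  ≡⟨ ∑-× elemsˣ (elems k) ⟩
  4 * ∑ (elems k) (λ _ → 1)    ≡⟨ cong (4 *_) (length-∑ (elems k)) ⟨
  4 * length (elems k)         ≡⟨ cong (4 *_) (length-elems k) ⟩
  4 * (8 * 4 ^ k)              ≡⟨ *-assoc 4 8 (4 ^ k) ⟨
  8 * 4 * 4 ^ k                ≡⟨ *-assoc 8 4 (4 ^ k) ⟩
  8 * 4 ^ suc k                ∎
  where open ≡-Reasoning

weight-formula : ∀ k → 3 * weight k + 8 ≡ 8 * 4 ^ suc k
weight-formula zero = refl
weight-formula (suc k) = begin
  3 * (4 * length (elems k) + weight k) + 8   ≡⟨ cong (λ e → 3 * (4 * e + weight k) + 8) (length-elems k) ⟩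
  3 * (4 * (8 * 4 ^ k) + weight k) + 8        ≡⟨ regroup (4 ^ k) (weight k) ⟩
  12 * (8 * 4 ^ k) + (3 * weight k + 8)       ≡⟨ cong (12 * (8 * 4 ^ k) +_) (weight-formula k) ⟩
  12 * (8 * 4 ^ k) + 8 * 4 ^ suc k            ≡⟨ total (4 ^ k) ⟩
  8 * 4 ^ (2 + k)                             ∎
  where
  open ≡-Reasoning
  regroup : ∀ x w → 3 * (4 * (8 * x) + w) + 8 ≡ 12 * (8 * x) + (3 * w + 8)
  regroup = solve-∀
  total : ∀ x → 12 * (8 * x) + 8 * (4 * x) ≡ 8 * (4 * (4 * x))
  total = solve-∀

-- The neighbour lists agree with the adjacency relations

[_]·_ : Bool → ℕ → ℕ
[ p ]· n = if p then n else 0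

[]·-∧ : ∀ p q n → [ p ∧ q ]· n ≡ [ p ]· ([ q ]· n)
[]·-∧ true q n = refl
[]·-∧ false q n = refl

[]·-∨ : ∀ p q n → p ∧ q ≡ false → [ p ∨ q ]· n ≡ [ p ]· n + [ q ]· n
[]·-∨ true false n _ = sym (+-identityʳ n)
[]·-∨ false q n _ = refl

[]·-split : ∀ p q r s n → p ∧ q ≡ false →
  [ (p ∧ r) ∨ (q ∧ s) ]· n ≡ [ p ]· ([ r ]· n) + [ q ]· ([ s ]· n)
[]·-split true false r s n _ = trans ([]·-∨ r false n (∧-zeroʳ r)) refl
[]·-split false q r s n _ = []·-∧ q s n

∑-[]· : ∀ p (xs : List A) (h : A → ℕ) → ∑ xs (λ x → [ p ]· h x) ≡ [ p ]· ∑ xs h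
∑-[]· true xs h = refl
∑-[]· false xs h = ∑-zero xs

∑-[]·-∧ : ∀ p (q : A → Bool) xs (h : A → ℕ) →
  ∑ xs (λ x → [ p ∧ q x ]· h x) ≡ [ p ]· ∑ xs (λ x → [ q x ]· h x)
∑-[]·-∧ true q xs h = refl
∑-[]·-∧ false q xs h = ∑-zero xs

∑-filterᵇ : ∀ (p : A → Bool) xs (h : A → ℕ) → ∑ (filterᵇ p xs) h ≡ ∑ xs (λ x → [ p x ]· h x)
∑-filterᵇ p [] h = refl
∑-filterᵇ p (x ∷ xs) h with p x
... | true = cong (h x +_) (∑-filterᵇ p xs h)
... | false = ∑-filterᵇ p xs h

Disjoint : (A → A → Bool) → (A → A → Bool) → Set
Disjoint ad eq = ∀ x y → ad x y ∧ eq x y ≡ false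

-- `∑-eq` says that `xs` lists every element exactly once. `disjoint` makes the disjunction in
-- `powAdj` exclusive, so its indicator is a sum of two indicators.
module Power (xs : List A) (eq ad : A → A → Bool) (disjoint : Disjoint ad eq)
  (∑-eq : ∀ x (h : A → ℕ) → ∑ xs (λ y → [ eq x y ]· h y) ≡ h x) where

  open ≡-Reasoning

  nb : A → List A
  nb x = filterᵇ (ad x) xs

  disjointᵛ : ∀ {n} → Disjoint {Vec A n} (powAdj eq ad) (vecEq eq)
  disjointᵛ [] [] = refl
  disjointᵛ (x ∷ u) (y ∷ v) with ad x y | eq x y | disjoint x y | disjointᵛ u v
  ... | true | false | _ | _ = ∧-zeroʳ _
  ... | false | true | _ | d = d
  ... | false | false | _ | _ = refl

  ∑-allVecs : ∀ n (h : Vec A (suc n) → ℕ) →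
    ∑ (allVecs (suc n) xs) h ≡ ∑ xs (λ y → ∑ (allVecs n xs) (λ v → h (y ∷ v)))
  ∑-allVecs n h = trans (∑-concatMap (λ y → map (y ∷_) (allVecs n xs)) xs)
    (∑-cong xs (λ y → ∑-map (y ∷_) (allVecs n xs)))

  ∑-vecEq : ∀ {n} (u : Vec A n) h → ∑ (allVecs n xs) (λ v → [ vecEq eq u v ]· h v) ≡ h u
  ∑-vecEq [] h = +-identityʳ (h [])
  ∑-vecEq {suc n} (x ∷ u) h = begin
    ∑ (allVecs (suc n) xs) (λ v → [ vecEq eq (x ∷ u) v ]· h v)
      ≡⟨ ∑-allVecs n _ ⟩
    ∑ xs (λ y → ∑ (allVecs n xs) (λ v → [ eq x y ∧ vecEq eq u v ]· h (y ∷ v)))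
      ≡⟨ ∑-cong xs (λ y → trans (∑-[]·-∧ (eq x y) (vecEq eq u) (allVecs n xs) (λ v → h (y ∷ v)))
           (cong ([ eq x y ]·_) (∑-vecEq u (λ v → h (y ∷ v))))) ⟩
    ∑ xs (λ y → [ eq x y ]· h (y ∷ u))
      ≡⟨ ∑-eq x _ ⟩
    h (x ∷ u) ∎

  ∑-powAdj : ∀ {n} (u : Vec A n) h →
    ∑ (allVecs n xs) (λ v → [ powAdj eq ad u v ]· h v) ≡ ∑ (nbrsᵛ nb u) h
  ∑-powAdj [] h = refl
  ∑-powAdj {suc n} (x ∷ u) h = begin
    ∑ (allVecs (suc n) xs) (λ v → [ powAdj eq ad (x ∷ u) v ]· h v)
      ≡⟨ ∑-allVecs n _ ⟩
    ∑ xs (λ y → ∑ (allVecs n xs) (λ v → [ (ad x y ∧ vecEq eq u v) ∨ (eq x y ∧ powAdj eq ad u v) ]· h (y ∷ v)))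
      ≡⟨ ∑-cong xs (λ y → trans (∑-cong (allVecs n xs) (λ v → []·-split (ad x y) (eq x y) (vecEq eq u v) (powAdj eq ad u v) (h (y ∷ v)) (disjoint x y))) (∑-+ (allVecs n xs))) ⟩
    ∑ xs (λ y → ∑ (allVecs n xs) (λ v → [ ad x y ]· ([ vecEq eq u v ]· h (y ∷ v)))
              + ∑ (allVecs n xs) (λ v → [ eq x y ]· ([ powAdj eq ad u v ]· h (y ∷ v))))
      ≡⟨ ∑-cong xs (λ y → cong₂ _+_
           (trans (∑-[]· (ad x y) (allVecs n xs) _) (cong ([ ad x y ]·_) (∑-vecEq u (λ v → h (y ∷ v)))))
           (trans (∑-[]· (eq x y) (allVecs n xs) _) (cong ([ eq x y ]·_) (∑-powAdj u (λ v → h (y ∷ v)))))) ⟩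
    ∑ xs (λ y → [ ad x y ]· h (y ∷ u) + [ eq x y ]· ∑ (nbrsᵛ nb u) (λ v → h (y ∷ v)))
      ≡⟨ ∑-+ xs ⟩
    ∑ xs (λ y → [ ad x y ]· h (y ∷ u)) + ∑ xs (λ y → [ eq x y ]· ∑ (nbrsᵛ nb u) (λ v → h (y ∷ v)))
      ≡⟨ cong₂ _+_ (sym (∑-filterᵇ (ad x) xs _)) (∑-eq x _) ⟩
    ∑ (nb x) (λ y → h (y ∷ u)) + ∑ (nbrsᵛ nb u) (λ v → h (x ∷ v))
      ≡⟨ ∑ᵛ-∷ nb x u ⟨
    ∑ (nbrsᵛ nb (x ∷ u)) h ∎

∑-==₄ : ∀ x (h : Fin 4 → ℕ) → ∑ (allFin 4) (λ y → [ x ==₄ y ]· h y) ≡ h x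
∑-==₄ 0F h = +-identityʳ _
∑-==₄ 1F h = +-identityʳ _
∑-==₄ 2F h = +-identityʳ _
∑-==₄ 3F h = +-identityʳ _

∑-==S : ∀ x (h : S → ℕ) → ∑ allS (λ y → [ x ==S y ]· h y) ≡ h x
∑-==S (x , y) h = begin
  ∑ allS (λ z → [ (x , y) ==S z ]· h z)
    ≡⟨ ∑-× (allFin 4) (allFin 4) {λ z → [ (x , y) ==S z ]· h z} ⟩
  ∑ (allFin 4) (λ x′ → ∑ (allFin 4) (λ y′ → [ (x ==₄ x′) ∧ (y ==₄ y′) ]· h (x′ , y′)))
    ≡⟨ ∑-cong (allFin 4) (λ x′ → trans (∑-[]·-∧ (x ==₄ x′) (y ==₄_) (allFin 4) (λ y′ → h (x′ , y′)))
         (cong ([ x ==₄ x′ ]·_) (∑-==₄ y (λ y′ → h (x′ , y′))))) ⟩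
  ∑ (allFin 4) (λ x′ → [ x ==₄ x′ ]· h (x′ , y))
    ≡⟨ ∑-==₄ x (λ x′ → h (x′ , y)) ⟩
  h (x , y) ∎
  where open ≡-Reasoning

k4Adj-irreflexive : Disjoint k4Adj _==₄_
k4Adj-irreflexive = certify (exhaust₄ λ x → exhaust₄ λ y → dec⇒maybe (_ ≟ᵇ _))

shrikhandeAdj-irreflexive : Disjoint shrikhandeAdj _==S_
shrikhandeAdj-irreflexive = certify (exhaustˢ λ x → exhaustˢ λ y → dec⇒maybe (_ ≟ᵇ _))

module Kᵖ = Power (allFin 4) _==₄_ k4Adj k4Adj-irreflexive ∑-==₄
module Sᵖ = Power allS _==S_ shrikhandeAdj shrikhandeAdj-irreflexive ∑-==S

∑-adj : ∀ m n (v : V (D m n)) h →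
  ∑ (verts (D m n)) (λ w → [ adj (D m n) v w ]· h w) ≡ ∑ (nbrsᴰ v) h
∑-adj m n (u₁ , u₂) h = begin
  ∑ (verts (D m n)) (λ w → [ adj (D m n) (u₁ , u₂) w ]· h w)
    ≡⟨ ∑-× Us Vs ⟩
  ∑ Us (λ v₁ → ∑ Vs (λ v₂ → [ (a₁ v₁ ∧ e₂ v₂) ∨ (e₁ v₁ ∧ a₂ v₂) ]· h (v₁ , v₂)))
    ≡⟨ ∑-cong Us (λ v₁ → trans (∑-cong Vs (λ v₂ → []·-split (a₁ v₁) (e₁ v₁) (e₂ v₂) (a₂ v₂) (h (v₁ , v₂)) (Sᵖ.disjointᵛ u₁ v₁))) (∑-+ Vs)) ⟩
  ∑ Us (λ v₁ → ∑ Vs (λ v₂ → [ a₁ v₁ ]· ([ e₂ v₂ ]· h (v₁ , v₂)))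
             + ∑ Vs (λ v₂ → [ e₁ v₁ ]· ([ a₂ v₂ ]· h (v₁ , v₂))))
    ≡⟨ ∑-cong Us (λ v₁ → cong₂ _+_
         (trans (∑-[]· (a₁ v₁) Vs _) (cong ([ a₁ v₁ ]·_) (Kᵖ.∑-vecEq u₂ (λ v₂ → h (v₁ , v₂)))))
         (trans (∑-[]· (e₁ v₁) Vs _) (cong ([ e₁ v₁ ]·_) (Kᵖ.∑-powAdj u₂ (λ v₂ → h (v₁ , v₂)))))) ⟩
  ∑ Us (λ v₁ → [ a₁ v₁ ]· h (v₁ , u₂) + [ e₁ v₁ ]· ∑ (nbrsᵛ nbrsᴷ u₂) (λ v₂ → h (v₁ , v₂)))
    ≡⟨ ∑-+ Us ⟩
  ∑ Us (λ v₁ → [ a₁ v₁ ]· h (v₁ , u₂)) + ∑ Us (λ v₁ → [ e₁ v₁ ]· ∑ (nbrsᵛ nbrsᴷ u₂) (λ v₂ → h (v₁ , v₂)))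
    ≡⟨ cong₂ _+_ (Sᵖ.∑-powAdj u₁ _) (Sᵖ.∑-vecEq u₁ _) ⟩
  ∑ (nbrsᵛ nbrsˢ u₁) (λ v₁ → h (v₁ , u₂)) + ∑ (nbrsᵛ nbrsᴷ u₂) (λ v₂ → h (u₁ , v₂))
    ≡⟨ ∑ᴰ u₁ u₂ ⟨
  ∑ (nbrsᴰ (u₁ , u₂)) h ∎
  where
  open ≡-Reasoning
  Us = allVecs m allS
  Vs = allVecs n (allFin 4)
  a₁ = powAdj _==S_ shrikhandeAdj u₁
  e₁ = vecEq _==S_ u₁
  a₂ = powAdj _==₄_ k4Adj u₂
  e₂ = vecEq _==₄_ u₂

-- Neighbour counts by colour as sums

δ : Fin 2 → Fin 2 → ℕ
δ j x = [ ⌊ x ≟ j ⌋ ]· 1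

nbrsOfColour-∑ : ∀ m n f v j → nbrsOfColour (D m n) f v j ≡ ∑ (nbrsᴰ v) (λ w → δ j (f w))
nbrsOfColour-∑ m n f v j = begin
  length (filterᵇ p (verts (D m n)))                               ≡⟨ length-∑ (filterᵇ p (verts (D m n))) ⟩
  ∑ (filterᵇ p (verts (D m n))) (λ _ → 1)                          ≡⟨ ∑-filterᵇ p (verts (D m n)) _ ⟩
  ∑ (verts (D m n)) (λ w → [ p w ]· 1)                             ≡⟨ ∑-cong (verts (D m n)) (λ w → []·-∧ (adj (D m n) v w) _ 1) ⟩
  ∑ (verts (D m n)) (λ w → [ adj (D m n) v w ]· δ j (f w))         ≡⟨ ∑-adj m n v _ ⟩
  ∑ (nbrsᴰ v) (λ w → δ j (f w))                                    ∎
  where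
  open ≡-Reasoning
  p : V (D m n) → Bool
  p w = adj (D m n) v w ∧ ⌊ f w ≟ j ⌋

-- The subsets of Z₄² attached to a part: for each shape the eight translates
-- by τ cover every point equally often, and each is an eigenset of the
-- Shrikhande graph for the eigenvalue -2.
data Shape : Set where
  none three four five full : Shape

size : Shape → ℕ
size none = 0
size three = 3
size four = 4
size five = 5
size full = 8

opposite : Fin 2 → Fin 2
opposite 0F = 1F
opposite 1F = 0F

-- Colour 0F is the subset itself.
hexad : S → Fin 2
hexad (0F , 0F) = 0F
hexad (0F , 1F) = 0F
hexad (1F , 3F) = 0F
hexad (2F , 0F) = 0F
hexad (2F , 2F) = 0F
hexad (3F , 2F) = 0F
hexad _ = 1F

parity : Fin 4 → Fin 2
parity 0F = 0F
parity 1F = 1F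
parity 2F = 0F
parity 3F = 1F

colourˢ : Shape → S → Fin 2
colourˢ none _ = 1F
colourˢ three y = hexad y
colourˢ four (x , _) = parity x
colourˢ five y = opposite (hexad y)
colourˢ full _ = 0F

τ : Carrier Z₂³ → S
τ (e , false , false) = 0F , (if e then 1F else 0F)
τ (e , false , true) = 1F , (if e then 1F else 0F)
τ (e , true , false) = 2F , (if e then 1F else 0F)
τ (e , true , true) = 3F , (if e then 1F else 0F)

χ : Shape → Carrier Z₂³ → S → Fin 2
χ s e y = colourˢ s (τ e ⊕[ Z₄² ] y)

share : Fin 2 → Shape → ℕ
share 0F s = size s
share 1F s = 8 ∸ size s

exhaustShape : Exhaust Shape
exhaustShape p = zipWith (λ { (a , b) (c , d , e) → λ { none → a ; three → b ; four → c ; five → d ; full → e } })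
  (zipWith _,_ (p none) (p three)) (zipWith _,_ (p four) (zipWith _,_ (p five) (p full)))

-- `τ` runs through Z₄ × {0, 1}. The second coordinates 0, 1, 2, 3 occur 2, 1, 2, 1 times in
-- `hexad`, so any two cyclically consecutive ones account for three points.
χ-share : ∀ s y j → ∑ (elems 0) (λ e → δ j (χ s e y)) ≡ share j s
χ-share = certify (exhaustShape λ s → exhaustˢ λ y → exhaust₂ λ j → dec⇒maybe (_ ≟ⁿ _))

-- For p = 2, q = 0 the eigenvalue is -2; for p = 0, q = 1 it is 1.
Eigen : List S → ℕ → ℕ → Set
Eigen T p q = ∀ s e y j →
  ∑ T (λ t → δ j (χ s e (t ⊕[ Z₄² ] y))) + p * δ j (χ s e y) ≡ share j s + q * δ j (χ s e y)

eigen-connˢ : Eigen connˢ 2 0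
eigen-connˢ = certify (exhaustShape λ s → exhaust₈ λ e → exhaustˢ λ y → exhaust₂ λ j → dec⇒maybe (_ ≟ⁿ _))

-- Passing to the complementary graph turns the eigenvalue -2 into 1. The constant term is the same
-- as for S, since 6 + 2 = 9 - 1 = 8 times the density.
eigen-coconnˢ : Eigen coconnˢ 0 1
eigen-coconnˢ = certify (exhaustShape λ s → exhaust₈ λ e → exhaustˢ λ y → exhaust₂ λ j → dec⇒maybe (_ ≟ⁿ _))

-- The colouring of F × R and its neighbour counts

∑< : ℕ → (ℕ → ℕ) → ℕ
∑< zero f = 0
∑< (suc n) f = f 0 + ∑< n (f ∘ suc)

∑<-+ : ∀ m n f → ∑< (m + n) f ≡ ∑< m f + ∑< n (f ∘ (m +_))
∑<-+ zero n f = refl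
∑<-+ (suc m) n f = trans (cong (f 0 +_) (∑<-+ m n (f ∘ suc))) (sym (+-assoc (f 0) _ _))

skip : ℕ → X → ℕ → ℕ
skip m (false , false) i = i
skip m (false , true) i = m + i
skip m (true , false) i = m + (m + i)
skip m (true , true) i = m + (m + (m + i))

-- The `Z₂²` coordinates name the coset of L; read as base-four digits, they give the index of the
-- part in `ρ`.
shapeAt : ∀ k → (ℕ → Shape) → Carrier (C k) → Shape
shapeAt zero ρ _ = ρ 0
shapeAt (suc k) ρ (x , c) = shapeAt k (ρ ∘ skip (4 ^ k) x) c

inPart : ∀ k → Carrier (C k) → Carrier Z₂³
inPart zero e = e
inPart (suc k) (_ , c) = inPart k c

shapeAt-inL : ∀ k ρ e c → shapeAt k ρ (inL k e ⊕[ C k ] c) ≡ shapeAt k ρ c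
shapeAt-inL zero ρ e c = refl
shapeAt-inL (suc k) ρ e (x , c) = shapeAt-inL k (ρ ∘ skip (4 ^ k) x) e c

inPart-inL : ∀ k e c → inPart k (inL k e ⊕[ C k ] c) ≡ e ⊕[ Z₂³ ] inPart k c
inPart-inL zero e c = refl
inPart-inL (suc k) e (x , c) = inPart-inL k e c

colour : ∀ k → (ℕ → Shape) → Carrier (Z₄² ⊗ C k) → Fin 2
colour k ρ (y , c) = χ (shapeAt k ρ c) (inPart k c) y

colour-total : ∀ k ρ y j →
  ∑ (elems k) (λ c → δ j (colour k ρ (y , c))) ≡ ∑< (4 ^ k) (share j ∘ ρ)
colour-total zero ρ y j = trans (χ-share (ρ 0) y j) (sym (+-identityʳ _))
colour-total (suc k) ρ y j = begin
  ∑ (elems (suc k)) (λ c → δ j (colour (suc k) ρ (y , c)))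
    ≡⟨ ∑-× elemsˣ (elems k) {λ c → δ j (colour (suc k) ρ (y , c))} ⟩
  ∑ elemsˣ (λ x → ∑ (elems k) (λ c → δ j (colour k (ρ ∘ skip g x) (y , c))))
    ≡⟨ ∑-cong elemsˣ (λ x → colour-total k (ρ ∘ skip g x) y j) ⟩
  ∑< g f + (∑< g (f ∘ (g +_)) + (∑< g (f ∘ (g +_) ∘ (g +_)) + (∑< g (f ∘ (g +_) ∘ (g +_) ∘ (g +_)) + 0)))
    ≡⟨ cong (λ z → ∑< g f + (∑< g (f ∘ (g +_)) + z)) (∑<-+ g (g + 0) (f ∘ (g +_) ∘ (g +_)) ∙ cong (∑< g (f ∘ (g +_) ∘ (g +_)) +_) (∑<-+ g 0 (f ∘ (g +_) ∘ (g +_) ∘ (g +_)))) ⟨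
  ∑< g f + (∑< g (f ∘ (g +_)) + ∑< (g + (g + 0)) (f ∘ (g +_) ∘ (g +_)))
    ≡⟨ cong (∑< g f +_) (∑<-+ g (g + (g + 0)) (f ∘ (g +_))) ⟨
  ∑< g f + ∑< (g + (g + (g + 0))) (f ∘ (g +_))
    ≡⟨ ∑<-+ g (g + (g + (g + 0))) f ⟨
  ∑< (4 ^ suc k) f ∎
  where
  open ≡-Reasoning
  _∙_ = trans
  g = 4 ^ k
  f = share j ∘ ρ

part-total : ∀ k ρ y c j →
  ∑ (elems 0) (λ e → δ j (colour k ρ (y , inL k e ⊕[ C k ] c))) ≡ share j (shapeAt k ρ c)
part-total k ρ y c j = begin
  ∑ (elems 0) (λ e → δ j (colour k ρ (y , inL k e ⊕[ C k ] c)))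
    ≡⟨ ∑-cong (elems 0) (λ e → cong₂ (λ s e′ → δ j (χ s e′ y)) (shapeAt-inL k ρ e c) (inPart-inL k e c)) ⟩
  ∑ (elems 0) (λ e → δ j (χ s (e ⊕[ Z₂³ ] inPart k c) y))
    ≡⟨ ⊕-permutes 0 (inPart k c) (λ e → δ j (χ s e y)) ⟩
  ∑ (elems 0) (λ e → δ j (χ s e y))
    ≡⟨ χ-share s y j ⟩
  share j s ∎
  where
  open ≡-Reasoning
  s = shapeAt k ρ c

withZero : ∀ k → List S → List (Carrier (Z₄² ⊗ C (suc k)))
withZero k T = map (_, ε (C (suc k))) T ++ map (ε Z₄² ,_) (outside k)

product-labelling : ∀ k {T} → Labelling a b Z₄² T → Labelling a′ b′ (C (suc k)) (outside k) →
  Labelling (a + a′) (b + b′) (Z₄² ⊗ C (suc k)) (withZero k T)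
product-labelling k F G =
  hom (_, ε (C (suc k))) (λ x y → cong (x ⊕[ Z₄² ] y ,_) (sym (⊕-identityˡ (C (suc k)) (ε (C (suc k)))))) F ⊎ᴸ
  hom (ε Z₄² ,_) (λ x y → cong (_, x ⊕[ C (suc k) ] y) (sym (⊕-identityˡ Z₄² (ε Z₄²)))) G

-- Neighbours in R see the shares of all parts but the own one, and neighbours in F supply the
-- missing share up to the eigenvalue term. The total is therefore the same for every vertex.
colour-nbrs : ∀ {m n k T p q} (F : Labelling m n (Z₄² ⊗ C (suc k)) (withZero k T)) → Eigen T p q → ∀ ρ v j →
  let f = colour (suc k) ρ ∘ label F in
  nbrsOfColour (D m n) f v j + p * δ j (f v) ≡ ∑< (4 ^ suc k) (share j ∘ ρ) + q * δ j (f v)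
colour-nbrs {m} {n} {k} {T} {p} {q} F eigen ρ v j = begin
  nbrsOfColour (D m n) f v j + p * d
    ≡⟨ cong (_+ p * d) (nbrsOfColour-∑ m n f v j) ⟩
  ∑ (nbrsᴰ v) (h ∘ label F) + p * d
    ≡⟨ cong (_+ p * d) (label-nbr F h v) ⟩
  ∑ (withZero k T) (λ t → h (t ⊕[ Z₄² ⊗ C (suc k) ] (y , c))) + p * d
    ≡⟨ cong (_+ p * d) (trans (∑-++ (map (_, ε (C (suc k))) T) _)
         (cong₂ _+_ (∑-map (_, ε (C (suc k))) T {h′}) (∑-map (ε Z₄² ,_) (outside k) {h′}))) ⟩
  ∑ T (λ t → h (t ⊕[ Z₄² ] y , ε (C (suc k)) ⊕[ C (suc k) ] c))
    + ∑ (outside k) (λ t → h (ε Z₄² ⊕[ Z₄² ] y , t ⊕[ C (suc k) ] c)) + p * d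
    ≡⟨ cong (_+ p * d) (cong₂ _+_
         (∑-cong T (λ t → cong (λ z → h (t ⊕[ Z₄² ] y , z)) (⊕-identityˡ (C (suc k)) c)))
         (∑-cong (outside k) (λ t → cong (λ z → h (z , t ⊕[ C (suc k) ] c)) (⊕-identityˡ Z₄² y)))) ⟩
  M + R + p * d
    ≡⟨ trans (+-assoc M R _) (trans (cong (M +_) (+-comm R _)) (sym (+-assoc M _ R))) ⟩
  M + p * d + R
    -- The neighbours in F are traded for the share of the part containing c.
    ≡⟨ cong (_+ R) (eigen (shapeAt (suc k) ρ c) (inPart (suc k) c) y j) ⟩
  share j s + q * d + R
    ≡⟨ trans (+-comm _ R) (sym (+-assoc R _ _)) ⟩
  R + share j s + q * d
    ≡⟨ cong (λ z → R + z + q * d) (part-total (suc k) ρ y c j) ⟨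
  R + ∑ (elems 0) (λ e → h (y , inL (suc k) e ⊕[ C (suc k) ] c)) + q * d
    -- That share, written as a sum over the coset of L, completes the sum over all labels.
    ≡⟨ cong (_+ q * d) (outside-⊕ k (λ c → h (y , c)) c) ⟩
  ∑ (elems (suc k)) (λ c → h (y , c)) + q * d
    ≡⟨ cong (_+ q * d) (colour-total (suc k) ρ y j) ⟩
  ∑< (4 ^ suc k) (share j ∘ ρ) + q * d ∎
  where
  open ≡-Reasoning
  f = colour (suc k) ρ ∘ label F
  h = δ j ∘ colour (suc k) ρ
  y = proj₁ (label F v)
  c = proj₂ (label F v)
  d = δ j (f v)
  s = shapeAt (suc k) ρ c
  h′ = λ t → h (t ⊕[ Z₄² ⊗ C (suc k) ] (y , c))
  M = ∑ T (λ t → h (t ⊕[ Z₄² ] y , c))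
  R = ∑ (outside k) (λ t → h (y , t ⊕[ C (suc k) ] c))

-- Choosing shapes with total size c

cons : Shape → (ℕ → Shape) → ℕ → Shape
cons s ρ zero = s
cons s ρ (suc i) = ρ i

-- Two parts suffice for 3 ≤ c ≤ 13; each further part is empty or full.
fill : ∀ g c → 3 ≤ c → c + 3 ≤ 8 * (2 + g) → ∃[ ρ ] ∑< (2 + g) (size ∘ ρ) ≡ c
fill zero 3 _ _ = cons three (λ _ → none) , refl
fill zero 4 _ _ = cons four (λ _ → none) , refl
fill zero 5 _ _ = cons five (λ _ → none) , refl
fill zero 6 _ _ = cons three (λ _ → three) , refl
fill zero 7 _ _ = cons three (λ _ → four) , refl
fill zero 8 _ _ = cons full (λ _ → none) , refl
fill zero 9 _ _ = cons four (λ _ → five) , refl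
fill zero 10 _ _ = cons five (λ _ → five) , refl
fill zero 11 _ _ = cons full (λ _ → three) , refl
fill zero 12 _ _ = cons full (λ _ → four) , refl
fill zero 13 _ _ = cons full (λ _ → five) , refl
fill zero 1 (s≤s ()) _
fill zero 2 (s≤s (s≤s ())) _
fill zero (suc (suc (suc (suc (suc (suc (suc (suc (suc (suc (suc (suc (suc (suc c)))))))))))))) _ c+3≤16 =
  contradiction (≤-trans (m≤n+m 3 c) (+-cancelˡ-≤ 14 _ _ c+3≤16)) λ { (s≤s (s≤s ())) }
fill (suc g) c 3≤c c+3≤ with c + 3 ≤? 8 * (2 + g)
... | yes small = let ρ , eq = fill g c 3≤c small in cons none ρ , eq
-- Here c + 3 exceeds 8 (2 + g), which is at least 16, so removing one full part leaves at least 3.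
... | no large = let ρ , eq = fill g (c ∸ 8) 3≤c∸8 bound in
  cons full ρ , trans (cong (8 +_) eq) (m+[n∸m]≡n 8≤c)
  where
  open ≤-Reasoning
  11≤c : 11 ≤ c
  11≤c = +-cancelʳ-≤ 3 11 c (begin
    14             ≤⟨ m≤m+n 14 2 ⟩
    8 * 2          ≤⟨ *-monoʳ-≤ 8 (m≤m+n 2 g) ⟩
    8 * (2 + g)    ≤⟨ <⇒≤ (≰⇒> large) ⟩
    c + 3          ∎)
  8≤c : 8 ≤ c
  8≤c = ≤-trans (m≤m+n 8 3) 11≤c
  3≤c∸8 : 3 ≤ c ∸ 8
  3≤c∸8 = ∸-monoˡ-≤ 8 11≤c
  bound : c ∸ 8 + 3 ≤ 8 * (2 + g)
  bound = +-cancelˡ-≤ 8 _ _ (begin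
    8 + (c ∸ 8 + 3)    ≡⟨ +-assoc 8 (c ∸ 8) 3 ⟨
    8 + (c ∸ 8) + 3    ≡⟨ cong (_+ 3) (m+[n∸m]≡n 8≤c) ⟩
    c + 3              ≤⟨ c+3≤ ⟩
    8 * (2 + suc g)    ≡⟨ *-suc 8 (2 + g) ⟩
    8 + 8 * (2 + g)    ∎)

share-total : ∀ g ρ → ∑< g (share 0F ∘ ρ) + ∑< g (share 1F ∘ ρ) ≡ 8 * g
share-total zero ρ = refl
share-total (suc g) ρ = trans (interchange (share 0F (ρ 0)) _ _ _)
  (trans (cong₂ _+_ (m+[n∸m]≡n (size≤8 (ρ 0))) (share-total g (ρ ∘ suc))) (sym (*-suc 8 g)))
  where
  size≤8 : ∀ s → size s ≤ 8
  size≤8 none = z≤n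
  size≤8 three = m≤m+n 3 5
  size≤8 four = m≤m+n 4 4
  size≤8 five = m≤m+n 5 3
  size≤8 full = ≤-refl

∑-δ-positive : ∀ (xs : List A) (f : A → Fin 2) j → 1 ≤ ∑ xs (δ j ∘ f) → ∃[ x ] f x ≡ j
∑-δ-positive (x ∷ xs) f j pos with f x ≟ j
... | yes fx≡j = x , fx≡j
... | no _ = ∑-δ-positive xs f j pos

-- From a labelling of F × R to a perfect colouring

module _ {m n k c b : ℕ} {T : List S} {p q : ℕ}
  (F : Labelling m n (Z₄² ⊗ C (suc k)) (withZero k T)) (eigen : Eigen T p q)
  (3≤c : 3 ≤ c) (3≤b : 3 ≤ b) (b+c : b + c ≡ 8 * 4 ^ suc k) where

  private
    2≤4^ : ∀ k → 2 ≤ 4 ^ suc k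
    2≤4^ k = ≤-trans (m≤m+n 2 2) (*-monoʳ-≤ 4 (m^n>0 4 k))

    allocation : ∃[ ρ ] ∑< (4 ^ suc k) (size ∘ ρ) ≡ c
    allocation = subst (λ g → ∃[ ρ ] ∑< g (size ∘ ρ) ≡ c) (m+[n∸m]≡n (2≤4^ k))
      (fill (4 ^ suc k ∸ 2) c 3≤c (begin
        c + 3                            ≤⟨ +-monoʳ-≤ c 3≤b ⟩
        c + b                            ≡⟨ trans (+-comm c b) b+c ⟩
        8 * 4 ^ suc k                    ≡⟨ cong (8 *_) (m+[n∸m]≡n (2≤4^ k)) ⟨
        8 * (2 + (4 ^ suc k ∸ 2))        ∎))
      where open ≤-Reasoning

    ρ = proj₁ allocation
    f = colour (suc k) ρ ∘ label F

    total : Fin 2 → ℕ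
    total 0F = c
    total 1F = b

    ∑-share : ∀ j → ∑< (4 ^ suc k) (share j ∘ ρ) ≡ total j
    ∑-share 0F = proj₂ allocation
    ∑-share 1F = +-cancelˡ-≡ c _ _ (begin
      c + W₁       ≡⟨ cong (_+ W₁) (proj₂ allocation) ⟨
      W₀ + W₁      ≡⟨ share-total (4 ^ suc k) ρ ⟩
      8 * 4 ^ suc k  ≡⟨ b+c ⟨
      b + c        ≡⟨ +-comm b c ⟩
      c + b        ∎)
      where
      open ≡-Reasoning
      W₀ = ∑< (4 ^ suc k) (share 0F ∘ ρ)
      W₁ = ∑< (4 ^ suc k) (share 1F ∘ ρ)

    N : V (D m n) → Fin 2 → ℕ
    N = nbrsOfColour (D m n) f

    nbrs : ∀ v j → N v j + p * δ j (f v) ≡ total j + q * δ j (f v)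
    nbrs v j = trans (colour-nbrs {k = k} {p = p} {q} F eigen ρ v j) (cong (_+ q * δ j (f v)) (∑-share j))

    M : Fin 2 → Fin 2 → ℕ
    M = mat2 (c + q ∸ p) b c (b + q ∸ p)

    same : ∀ {x} t → x + p * 1 ≡ t + q * 1 → x ≡ t + q ∸ p
    same {x} t eq = sym (trans (cong₂ (λ y z → t + y ∸ z) (sym (*-identityʳ q)) (sym (*-identityʳ p)))
      (trans (cong (_∸ p * 1) (sym eq)) (m+n∸n≡m x (p * 1))))

    different : ∀ {x} t → x + p * 0 ≡ t + q * 0 → x ≡ t
    different {x} t eq = begin
      x            ≡⟨ +-identityʳ x ⟨
      x + 0        ≡⟨ cong (x +_) (*-zeroʳ p) ⟨
      x + p * 0    ≡⟨ eq ⟩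
      t + q * 0    ≡⟨ cong (t +_) (*-zeroʳ q) ⟩
      t + 0        ≡⟨ +-identityʳ t ⟩
      t            ∎
      where open ≡-Reasoning

    counts : ∀ v j → N v j ≡ M (f v) j
    counts v j = go (f v) j (nbrs v j)
      where
      go : ∀ i j → N v j + p * δ j i ≡ total j + q * δ j i → N v j ≡ M i j
      go 0F 0F = same c
      go 0F 1F = different b
      go 1F 0F = different c
      go 1F 1F = same b

    v₀ : V (D m n)
    v₀ = Vec.replicate m (0F , 0F) , Vec.replicate n 0F

    adjacent : ∀ v j → 1 ≤ N v j → ∃[ w ] f w ≡ j
    adjacent v j pos = ∑-δ-positive (nbrsᴰ v) f j (subst (1 ≤_) (nbrsOfColour-∑ m n f v j) pos)

    -- The colour of `v₀` occurs at `v₀`, the other one among its neighbours, because b and c are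
    -- positive.
    onto : ∀ i j → f v₀ ≡ i → ∃[ w ] f w ≡ j
    onto 0F 0F eq = v₀ , eq
    onto 1F 1F eq = v₀ , eq
    onto 0F 1F eq = adjacent v₀ 1F (subst (1 ≤_)
      (sym (trans (counts v₀ 1F) (cong (λ i → M i 1F) eq))) (≤-trans (m≤m+n 1 2) 3≤b))
    onto 1F 0F eq = adjacent v₀ 0F (subst (1 ≤_)
      (sym (trans (counts v₀ 0F) (cong (λ i → M i 0F) eq))) (≤-trans (m≤m+n 1 2) 3≤c))

  colouring : HasPerfect2Colouring (D m n) (mat2 (c + q ∸ p) b c (b + q ∸ p))
  colouring = f , (λ j → onto (f v₀) j refl) , counts

-- Arithmetic of the parameters and conclusion

-- As b + c is even, c = 2 would make b even too.
coprime⇒≢2 : ∀ {b c} N → gcd b c ≡ 1 → b + c ≡ 2 * N → c ≢ 2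
coprime⇒≢2 {b} {c} N coprime eq refl = contradiction
  (∣1⇒≡1 (subst (2 ∣_) coprime (gcd-greatest
    (∣m+n∣m⇒∣n (subst (2 ∣_) (trans (sym eq) (+-comm b 2)) (m∣m*n N)) (divides 1 refl)) (divides 1 refl))))
  λ ()

≢1∧≢2⇒3≤ : ∀ {c} → 1 ≤ c → c ≢ 1 → c ≢ 2 → 3 ≤ c
≢1∧≢2⇒3≤ {1} _ c≢1 _ = contradiction refl c≢1
≢1∧≢2⇒3≤ {2} _ _ c≢2 = contradiction refl c≢2
≢1∧≢2⇒3≤ {suc (suc (suc c))} _ _ _ = s≤s (s≤s (s≤s z≤n))

2^[2l-1] : ∀ k → 2 ^ (2 * (3 + k) ∸ 1) ≡ 8 * 4 ^ suc k
2^[2l-1] k = begin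
  2 ^ (2 * (3 + k) ∸ 1)     ≡⟨ cong (λ e → 2 ^ (e ∸ 1)) (exponent k) ⟩
  2 ^ (3 + 2 * suc k)       ≡⟨ ^-distribˡ-+-* 2 3 (2 * suc k) ⟩
  8 * 2 ^ (2 * suc k)       ≡⟨ cong (8 *_) (^-*-assoc 2 2 (suc k)) ⟨
  8 * 4 ^ suc k             ∎
  where
  open ≡-Reasoning
  exponent : ∀ k → 2 * (3 + k) ≡ 4 + 2 * suc k
  exponent = solve-∀

8≤weight : ∀ k → 8 ≤ weight k
8≤weight zero = ≤-refl
8≤weight (suc k) = m≤n⇒m≤o+n _ (8≤weight k)

theorem7 : ∀ (b c l : ℕ) → 1 ≤ b → 1 ≤ c → gcd b c ≡ 1 → b ≢ 1 → c ≢ 1 → 3 ≤ l →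
    b + c ≡ 2 ^ (2 * l ∸ 1) →
    (∀ (m n : ℕ) → 1 ≤ m → 8 ≤ n → 3 * (2 * m + n) + 2 ≡ b + c →
    HasPerfect2Colouring (D m n) (mat2 (c ∸ 2) b c (b ∸ 2)))
    × (∀ (n : ℕ) → 3 * n ≡ b + c + 1 →
    HasPerfect2Colouring (H4 n) (mat2 (c + 1) b c (b + 1)))
theorem7 b c (suc (suc (suc k))) 1≤b 1≤c coprime b≢1 c≢1 (s≤s (s≤s (s≤s _))) b+c≡2^ = doob , hamming
  where
  open ≡-Reasoning
  -- With l = 3 + k, the sum b + c is the order of `C (suc k)`.
  b+c : b + c ≡ 8 * 4 ^ suc k
  b+c = trans b+c≡2^ (2^[2l-1] k)

  even : 8 * 4 ^ suc k ≡ 2 * (4 * 4 ^ suc k)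
  even = *-assoc 2 4 (4 ^ suc k)

  3≤c : 3 ≤ c
  3≤c = ≢1∧≢2⇒3≤ 1≤c c≢1 (coprime⇒≢2 (4 * 4 ^ suc k) coprime (trans b+c even))

  3≤b : 3 ≤ b
  3≤b = ≢1∧≢2⇒3≤ 1≤b b≢1 (coprime⇒≢2 (4 * 4 ^ suc k) (trans (gcd-comm c b) coprime) (trans (+-comm c b) (trans b+c even)))

  b+c-weight : b + c ≡ 3 * weight k + 8
  b+c-weight = trans b+c (sym (weight-formula k))

  doob : ∀ (m n : ℕ) → 1 ≤ m → 8 ≤ n → 3 * (2 * m + n) + 2 ≡ b + c →
    HasPerfect2Colouring (D m n) (mat2 (c ∸ 2) b c (b ∸ 2))
  -- One copy of S serves as F; the other m copies and all factors K₄ form R.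
  doob (suc m) n _ 8≤n eq = subst₂ (λ x y → HasPerfect2Colouring (D (suc m) n) (mat2 (x ∸ 2) b c (y ∸ 2)))
    (+-identityʳ c) (+-identityʳ b)
    (colouring {k = k} {p = 2} {q = 0}
      (product-labelling k S-Z₄² (outside-all k m n rest 8≤n)) eigen-connˢ 3≤c 3≤b b+c)
    where
    regroup : ∀ m n → 3 * (2 * suc m + n) + 2 ≡ 3 * (2 * m + n) + 8
    regroup = solve-∀
    rest : 2 * m + n ≡ weight k
    rest = *-cancelˡ-≡ _ _ 3 (+-cancelʳ-≡ 8 _ _
      (trans (sym (regroup m n)) (trans eq b+c-weight)))

  hamming : ∀ (n : ℕ) → 3 * n ≡ b + c + 1 → HasPerfect2Colouring (H4 n) (mat2 (c + 1) b c (b + 1))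
  -- Three factors K₄ serve as F, and R consists of the remaining `weight k` of them.
  hamming n eq = subst (λ n → HasPerfect2Colouring (H4 n) (mat2 (c + 1) b c (b + 1))) (sym n≡)
    (colouring {k = k} {p = 0} {q = 1}
      (product-labelling k K₄³-Z₄² (outside-all k 0 (weight k) refl (8≤weight k))) eigen-coconnˢ 3≤c 3≤b b+c)
    where
    regroup : ∀ w → 3 * w + 8 + 1 ≡ 3 * (3 + w)
    regroup = solve-∀
    n≡ : n ≡ 3 + weight k
    n≡ = *-cancelˡ-≡ _ _ 3 (trans eq (trans (cong (_+ 1) b+c-weight) (regroup (weight k))))
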